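{- Let $n\ge1$. For $u=x_{F_1}^{a_1}\cdots x_{F_\ell}^{a_\ell}\in\widetilde{FY}(\mathsf{B}_n)$ (with $F_0=\emptyset$) define $\widetilde\phi(u)=(\alpha_1\cdots\alpha_n,f)$ as follows. If $a_1=1$, then $$\alpha_i=\begin{cases} j-1&\text{if } i\in F_j\setminus F_{j-1}\\ \infty&\text{if } i\in[n]\setminus F_\ell\end{cases}\quad(i\in[n]),\qquad f(j)=a_{j+1}\ \text{ for } j\in[\ell-1];$$ if $a_1\ge2$, then $$\alpha_i=\begin{cases} j&\text{if } i\in F_j\setminus F_{j-1}\\ \infty&\text{if } i\in[n]\setminus F_\ell\end{cases}\quad(i\in[n]),\qquad f(1)=a_1-1\ \text{ and }\ f(j)=a_j\ \text{ for } 2\le j\le\ell;$$ and $\widetilde\phi(1)=\infty\cdots\infty$ for the empty monomial ($\ell=0$). Then $\widetilde\phi:\widetilde{FY}(\mathsf{B}_n)\to\widetilde{\mathtt{Code}}_n=\bigcup_{j=-1}^{n-1}\widetilde{\mathtt{Code}}_{n,j}$ is a bijection that satisfies $\deg(u)=\mathrm{ind}(\widetilde\phi(u))+1$ and respects the $\mathfrak{S}_n$-actions on both sets, i.e. $\widetilde\phi(\sigma\cdot u)=\sigma\cdot\widetilde\phi(u)$ for all $\sigma\in\mathfrak{S}_n$.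
   Context: Write $[n]=\{1,\dots,n\}$. $\widetilde{FY}(\mathsf{B}_n)$ is the set of formal monomials $x_{F_1}^{a_1}\cdots x_{F_\ell}^{a_\ell}$ with $\ell\ge0$, $\emptyset\subsetneq F_1\subsetneq\cdots\subsetneq F_\ell\subseteq[n]$, $1\le a_1\le|F_1|$, and $1\le a_i\le|F_i|-|F_{i-1}|-1$ for $i\ge2$ ($\ell=0$ gives the monomial $1$). The degree is $\deg(u)=a_1+\cdots+a_\ell$. $\mathfrak{S}_n$ acts by $\sigma\cdot x_{F_1}^{a_1}\cdots x_{F_\ell}^{a_\ell}=x_{\sigma(F_1)}^{a_1}\cdots x_{\sigma(F_\ell)}^{a_\ell}$. An extended code of length $n$ is a pair $(\alpha,f)$ where $\alpha=\alpha_1\cdots\alpha_n$ is a sequence over $\{0,1,2,\dots\}\cup\{\infty\}$ such that, with $m(\alpha)$ the maximum finite number appearing in $\alpha$ (taken as $0$ if there is none), each $k\in\{1,\dots,m(\alpha)\}$ occurs at least twice in $\alpha$; and $f$ records a mark: for each such $k$ exactly one occurrence of $k$ other than the first is marked, and $f(k)$ is the number of occurrences of $k$ to the left of the marked one (so $1\le f(k)\le(\text{number of occurrences of }k)-1$). The letters $0$ and $\infty$ may occur any number of times. The index is $\mathrm{ind}(\alpha,f)=-1$ if $\alpha=\infty\cdots\infty$, and $\mathrm{ind}(\alpha,f)=\sum_{k=1}^{m(\alpha)}f(k)$ otherwise. $\widetilde{\mathtt{Code}}_{n,j}$ is the set of extended codes of length $n$ and index $j$. $\mathfrak{S}_n$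 acts by $\sigma\cdot(\alpha_1\cdots\alpha_n,f)=(\alpha_{\sigma^{ -1}(1)}\cdots\alpha_{\sigma^{ -1}(n)},f)$. -}

module Defs where

open import Algebra.Bundles using (CommutativeMonoid)
import Algebra.Properties.CommutativeMonoid.Sum as Sum
open import Data.Bool using (true; false; if_then_else_)
import Data.Bool as Bool
open import Data.Fin using (Fin; zero; suc; toℕ)
open import Data.Fin.Permutation using (Permutation′; _⟨$⟩ʳ_; _⟨$⟩ˡ_; flip; inverseˡ; inverseʳ)
open import Data.Fin.Subset using (Subset; inside; ⊥; ∣_∣; _∈_; _⊂_; _─_)
open import Data.Fin.Subset.Properties using (_∈?_; ∉⊥; ⊥⊆)
open import Data.Integer using (ℤ; +_; -1ℤ)
open import Data.List using (List; []; _∷_; length; map)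
import Data.List as List
open import Data.Nat using (ℕ; zero; suc; _∸_; _⊔_; _≤_; _≟_)
open import Data.Nat.ListAction using (sum)
open import Data.Nat.Properties using (+-0-commutativeMonoid; ⊔-0-commutativeMonoid)
open import Data.Product using (_×_; _,_; proj₁; proj₂)
open import Data.Refinement using (Refinement-syntax; _,_; value)
import Data.Refinement as Refinement
open import Data.Unit using (⊤; tt)
open import Data.Vec using (Vec; []; _∷_; lookup; tabulate; replicate; count)
import Data.Vec.Properties as Vec
open import Level using (Level)
open import Relation.Binary.Definitions using (DecidableEquality)
open import Relation.Binary.PropositionalEquality
open import Relation.Nullary using (does)
open import Relation.Nullary.Construct.Add.Supremum using (_⁺; ⊤⁺; [_]; ≡-dec)
open import Relation.Unary using (Decidable)

private
  variable
    n : ℕ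
    A : Set

-- The ground set [n] is Fin n.  Position i of the permuted vector holds the
-- old entry at position σ⁻¹(i); for a subset (a vector of booleans) this is
-- the image σ(F).
act : Permutation′ n → Vec A n → Vec A n
act σ v = tabulate λ i → lookup v (σ ⟨$⟩ˡ i)

------------------------------------------------------------------------
-- Monomials

-- x_{F₁}^{a₁} ⋯ x_{Fₗ}^{aₗ}  is the list  (F₁ , a₁) ∷ ⋯ ∷ (Fₗ , aₗ) ∷ [].
Monomial : ℕ → Set
Monomial n = List (Subset n × ℕ)

-- The truncated subtraction is exact, since E ⊂ F.
IsFYAbove : Subset n → Monomial n → Set
IsFYAbove E []            = ⊤
IsFYAbove E ((F , a) ∷ u) =
  E ⊂ F × 1 ≤ a × a ≤ ∣ F ∣ ∸ ∣ E ∣ ∸ 1 × IsFYAbove F u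

IsFY : Monomial n → Set
IsFY []            = ⊤
IsFY ((F , a) ∷ u) = ⊥ ⊂ F × 1 ≤ a × a ≤ ∣ F ∣ × IsFYAbove F u

-- Membership proofs are irrelevant, so _≡_ on FY n (and on Code n below) is
-- equality of the underlying data.
FY : ℕ → Set
FY n = [ u ∈ Monomial n ∣ IsFY u ]

exponents : Monomial n → List ℕ
exponents = map proj₂

deg : FY n → ℕ
deg u = sum (exponents (value u))

actMonomial : Permutation′ n → Monomial n → Monomial n
actMonomial σ = map λ (F , a) → act σ F , a

------------------------------------------------------------------------
-- Extended codes

Letter : Set
Letter = ℕ ⁺

pattern ∞ = ⊤⁺

infix 4 _≟ᴸ_
_≟ᴸ_ : DecidableEquality Letter
_≟ᴸ_ = ≡-dec _≟_

maxFinite : Vec Letter n → ℕ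
maxFinite []          = 0
maxFinite ([ k ] ∷ α) = k ⊔ maxFinite α
maxFinite (∞ ∷ α)     = maxFinite α

occurrences : ℕ → Vec Letter n → ℕ
occurrences k = count (_≟ᴸ [ k ])

-- The mark function f is stored as the list f(1), …, f(m), so that f(k) is the
-- entry at (zero-based) index k − 1; the number f(k) determines the marked
-- occurrence of k.
MarkedWord : ℕ → Set
MarkedWord n = Vec Letter n × List ℕ

record IsCode (c : MarkedWord n) : Set where
  private
    α = proj₁ c
    f = proj₂ c
  field
    domain      : length f ≡ maxFinite α
    occursTwice : ∀ (i : Fin (maxFinite α)) → 2 ≤ occurrences (suc (toℕ i)) α
    marked      : ∀ (i : Fin (length f)) →
                  1 ≤ List.lookup f i ×
                  List.lookup f i ≤ occurrences (suc (toℕ i)) α ∸ 1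

Code : ℕ → Set
Code n = [ c ∈ MarkedWord n ∣ IsCode c ]

ind : Code n → ℤ
ind {n} ((α , f) , _) =
  if does (Vec.≡-dec _≟ᴸ_ α (replicate n ∞)) then -1ℤ else + sum f

infix 4 _∈Code[_]
_∈Code[_] : Code n → ℤ → Set
c ∈Code[ j ] = ind c ≡ j

------------------------------------------------------------------------
-- The formula for φ̃

-- For u = x_{F₁}^{a₁} ⋯ x_{Fₗ}^{aₗ} and F₀ = E, the letter at i is  s + t − 1
-- if i ∈ Fₜ \ Fₜ₋₁, and ∞ if i lies in none of these differences.
blockLetter : Subset n → ℕ → Monomial n → Fin n → Letter
blockLetter E s []            i = ∞
blockLetter E s ((F , _) ∷ u) i =
  if does (i ∈? F ─ E) then [ s ] else blockLetter F (suc s) u i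

-- Exponent 0 does not occur in FY n; its value here is immaterial.
φ : Monomial n → MarkedWord n
φ {n} []              = replicate n ∞ , []
φ u@((F , 1) ∷ v)     = tabulate (blockLetter ⊥ 0 u) , exponents v
φ u@((F , a) ∷ v)     = tabulate (blockLetter ⊥ 1 u) , a ∸ 1 ∷ exponents v

------------------------------------------------------------------------
-- The symmetric group acts on FY n and on Code n

lookup-act : (σ : Permutation′ n) (v : Vec A n) (i : Fin n) →
             lookup (act σ v) i ≡ lookup v (σ ⟨$⟩ˡ i)
lookup-act σ v i = Vec.lookup∘tabulate (λ j → lookup v (σ ⟨$⟩ˡ j)) i

module _ {c ℓ : Level} (M : CommutativeMonoid c ℓ) where
  open CommutativeMonoid M using (Carrier; _≈_; reflexive)
    renaming (sym to ≈-sym; trans to ≈-trans)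
  open Sum M using (sum-permute; sum-cong-≗) renaming (sum to ∑)

  ∑-act : (g : A → Carrier) (σ : Permutation′ n) (v : Vec A n) →
          ∑ (λ i → g (lookup (act σ v) i)) ≈ ∑ (λ i → g (lookup v i))
  ∑-act g σ v = ≈-trans
    (reflexive (sum-cong-≗ λ i → cong g (lookup-act σ v i)))
    (≈-sym (sum-permute (λ i → g (lookup v i)) (flip σ)))

module _ {A : Set} {P : A → Set} (P? : Decidable P) where
  open Sum +-0-commutativeMonoid using () renaming (sum to ∑)

  private
    indicator : A → ℕ
    indicator x = if does (P? x) then 1 else 0

    count-∑ : (v : Vec A n) → count P? v ≡ ∑ (λ i → indicator (lookup v i))
    count-∑ []      = refl
    count-∑ (x ∷ v) with does (P? x)
    ... | true  = cong suc (count-∑ v)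
    ... | false = count-∑ v

  count-act : (σ : Permutation′ n) (v : Vec A n) → count P? (act σ v) ≡ count P? v
  count-act σ v = trans (count-∑ (act σ v))
    (trans (∑-act +-0-commutativeMonoid indicator σ v) (sym (count-∑ v)))

module _ where
  open Sum ⊔-0-commutativeMonoid using () renaming (sum to ⨆)

  private
    finitePart : Letter → ℕ
    finitePart [ k ] = k
    finitePart ∞     = 0

    maxFinite-⨆ : (α : Vec Letter n) → maxFinite α ≡ ⨆ (λ i → finitePart (lookup α i))
    maxFinite-⨆ []          = refl
    maxFinite-⨆ ([ k ] ∷ α) = cong (k ⊔_) (maxFinite-⨆ α)
    maxFinite-⨆ (∞ ∷ α)     = maxFinite-⨆ α

  maxFinite-act : (σ : Permutation′ n) (α : Vec Letter n) →
                  maxFinite (act σ α) ≡ maxFinite α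
  maxFinite-act σ α = trans (maxFinite-⨆ (act σ α))
    (trans (∑-act ⊔-0-commutativeMonoid finitePart σ α) (sym (maxFinite-⨆ α)))

∣act∣ : (σ : Permutation′ n) (F : Subset n) → ∣ act σ F ∣ ≡ ∣ F ∣
∣act∣ σ F = count-act (Bool._≟ inside) σ F

∈-act⁺ : (σ : Permutation′ n) (F : Subset n) {i : Fin n} → i ∈ F → σ ⟨$⟩ʳ i ∈ act σ F
∈-act⁺ σ F i∈F = Vec.lookup⇒[]= _ _
  (trans (lookup-act σ F _)
  (trans (cong (lookup F) (inverseˡ σ)) (Vec.[]=⇒lookup i∈F)))

∈-act⁻ : (σ : Permutation′ n) (F : Subset n) {i : Fin n} → i ∈ act σ F → σ ⟨$⟩ˡ i ∈ F
∈-act⁻ σ F i∈σF = Vec.lookup⇒[]= _ _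
  (trans (sym (lookup-act σ F _)) (Vec.[]=⇒lookup i∈σF))

act-⊂ : (σ : Permutation′ n) {E F : Subset n} → E ⊂ F → act σ E ⊂ act σ F
act-⊂ σ {E} {F} (E⊆F , x , x∈F , x∉E) =
  (λ i∈σE → subst (_∈ act σ F) (inverseʳ σ) (∈-act⁺ σ F (E⊆F (∈-act⁻ σ E i∈σE)))) ,
  σ ⟨$⟩ʳ x , ∈-act⁺ σ F x∈F ,
  λ σx∈σE → x∉E (subst (_∈ E) (inverseˡ σ) (∈-act⁻ σ E σx∈σE))

actIsFYAbove : (σ : Permutation′ n) {E : Subset n} (u : Monomial n) →
               IsFYAbove E u → IsFYAbove (act σ E) (actMonomial σ u)
actIsFYAbove σ         []            tt                     = tt
actIsFYAbove σ {E = E} ((F , a) ∷ u) (E⊂F , 1≤a , a≤ , uOK) =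
  act-⊂ σ E⊂F , 1≤a ,
  subst (a ≤_) (sym (cong₂ (λ x y → x ∸ y ∸ 1) (∣act∣ σ F) (∣act∣ σ E))) a≤ ,
  actIsFYAbove σ u uOK

actIsFY : (σ : Permutation′ n) (u : Monomial n) → IsFY u → IsFY (actMonomial σ u)
actIsFY σ []            tt                               = tt
actIsFY σ ((F , a) ∷ u) ((_ , x , x∈F , _) , 1≤a , a≤ , uOK) =
  (⊥⊆ , σ ⟨$⟩ʳ x , ∈-act⁺ σ F x∈F , ∉⊥) , 1≤a ,
  subst (a ≤_) (sym (∣act∣ σ F)) a≤ ,
  actIsFYAbove σ u uOK

actIsCode : (σ : Permutation′ n) ((α , f) : MarkedWord n) →
            IsCode (α , f) → IsCode (act σ α , f)
actIsCode σ (α , f) c = record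
  { domain      = trans domain (sym (maxFinite-act σ α))
  ; occursTwice = subst (λ m → ∀ (i : Fin m) → 2 ≤ occurrences (suc (toℕ i)) (act σ α))
                    (sym (maxFinite-act σ α))
                    (λ i → subst (2 ≤_) (sym (count-act (_≟ᴸ _) σ α)) (occursTwice i))
  ; marked      = λ i → proj₁ (marked i) ,
                    subst (λ m → List.lookup f i ≤ m ∸ 1)
                      (sym (count-act (_≟ᴸ _) σ α)) (proj₂ (marked i))
  }
  where open IsCode c

infixr 7 _•ᶠ_ _•ᶜ_

_•ᶠ_ : Permutation′ n → FY n → FY n
σ •ᶠ u = Refinement.map (actMonomial σ) (λ {v} → actIsFY σ v) u

_•ᶜ_ : Permutation′ n → Code n → Code n
σ •ᶜ c = Refinement.map (λ (α , f) → act σ α , f) (λ {d} → actIsCode σ d) c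

{-# OPTIONS --safe #-}

-- Both sides are encoded by pairs (F , v), where F is a possibly empty subset
-- and v is a flag above F satisfying the gap conditions.  A code gives the
-- set F of its zeros and the flag of sets {i : αᵢ ≤ k}, k ≥ 1, whose successive
-- cardinality gaps are the numbers of occurrences of k, so that the bounds on
-- marks and exponents agree.  A monomial gives F = F₁ if a₁ = 1; otherwise F = ∅
-- and v is the monomial with a₁ lowered by one, which turns a₁ ≤ |F₁| into the
-- gap condition above ∅.

module Submission where

open import Defs
open import Data.Bool using (Bool; true; false; _∧_; not)
import Data.Bool.Properties as Bool
open import Data.Fin using (Fin; zero; suc; toℕ; fromℕ<)
open import Data.Fin.Permutation using (Permutation′; _⟨$⟩ˡ_; inverseʳ)
open import Data.Fin.Properties using (toℕ-fromℕ<)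
open import Data.Fin.Subset using (Subset; ⊥; ∣_∣; _∈_; _∉_; _⊆_; _⊂_; _─_; Nonempty)
open import Data.Fin.Subset.Properties
open import Data.Integer using (+_; -1ℤ; 1ℤ; +≤+; -≤+)
  renaming (_+_ to _+ᶻ_; _-_ to _-ᶻ_; _≤_ to _≤ᶻ_)
import Data.Integer.Properties as ℤ
open import Data.Irrelevant using ([_])
open import Data.List using (List; []; _∷_; length)
import Data.List as List
import Data.List.Properties as List
open import Data.Nat using (ℕ; zero; suc; _+_; _∸_; _≤_; _<_; z≤n; s≤s; s≤s⁻¹; _<?_)
import Data.Nat as ℕ
open import Data.Nat.ListAction using (sum)
open import Data.Nat.Properties
open import Data.Product using (_×_; _,_; ∃-syntax; Σ-syntax; proj₁; proj₂)
import Data.Product.Properties as Product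
open import Data.Refinement using (value; proof; _,_; value-injective)
open import Data.Sum using (inj₁; inj₂)
open import Data.Unit using (⊤; tt)
open import Data.Vec using (Vec; []; _∷_; lookup; tabulate; replicate)
import Data.Vec as Vec
import Data.Vec.Properties as Vec
open import Function using (_∘_)
open import Function.Bundles using (mk⇔)
open import Function.Definitions using (Bijective)
open import Relation.Binary.Definitions using (tri<; tri≈; tri>; DecidableEquality)
open import Relation.Binary.PropositionalEquality
open import Relation.Nullary using (yes; no; does; contradiction)
open import Relation.Nullary.Construct.Add.Supremum using ([_]; []-injective)
open import Relation.Nullary.Decidable using (dec-true; dec-false; does-⇔; recompute)

private
  variable
    n s k m : ℕ
    i : Fin n
    α : Vec Letter n
    E F : Subset n

-- Letters of a word

belowᵇ : ℕ → Letter → Bool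
belowᵇ s [ k ] = does (k <? s)
belowᵇ s ∞     = false

-- The inequality is strict so that `below 0 α` is empty and `below 1 α` is the set of zeros.
below : ℕ → Vec Letter n → Subset n
below s = Vec.map (belowᵇ s)

∈-below⁺ : lookup α i ≡ [ k ] → k < s → i ∈ below s α
∈-below⁺ {α = α} {i = i} {s = s} eq k<s = Vec.lookup⇒[]= i _
  (trans (Vec.lookup-map i (belowᵇ s) α)
  (trans (cong (belowᵇ s) eq) (dec-true (_ <? s) k<s)))

∈-below⁻ : i ∈ below s α → ∃[ k ] (lookup α i ≡ [ k ] × k < s)
∈-below⁻ {i = i} {s = s} {α = α} i∈
  with lookup α i | trans (sym (Vec.lookup-map i (belowᵇ s) α)) (Vec.[]=⇒lookup i∈)
... | ∞     | ()
... | [ k ] | eq with k <? s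
...   | yes k<s = k , refl , k<s
...   | no  k≮s = contradiction (trans (sym eq) (dec-false (k <? s) k≮s)) λ ()

below-zero : (α : Vec Letter n) → below 0 α ≡ ⊥
below-zero α = Empty-unique λ (_ , i∈) → contradiction (proj₂ (proj₂ (∈-below⁻ i∈))) λ ()

-- Passing from `s` to `suc s` adds exactly the positions of the letter `s`; the head letter is
-- compared with `s`.
∣below-suc∣ : ∀ s (α : Vec Letter n) →
              ∣ below (suc s) α ∣ ≡ occurrences s α + ∣ below s α ∣
∣below-suc∣ s []          = refl
∣below-suc∣ s (∞ ∷ α)     = ∣below-suc∣ s α
∣below-suc∣ s ([ k ] ∷ α) with <-cmp k s
... | tri< k<s k≢s _
  rewrite dec-true (k <? suc s) (m<n⇒m<1+n k<s)
        | dec-false (k ℕ.≟ s) k≢s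
        | dec-true (k <? s) k<s
  = trans (cong suc (∣below-suc∣ s α)) (sym (+-suc _ _))
... | tri≈ k≮s k≡s _
  rewrite dec-true (k <? suc s) (s≤s (≤-reflexive k≡s))
        | dec-true (k ℕ.≟ s) k≡s
        | dec-false (k <? s) k≮s
  = cong suc (∣below-suc∣ s α)
... | tri> k≮s k≢s s<k
  rewrite dec-false (k <? suc s) (≤⇒≯ s<k)
        | dec-false (k ℕ.≟ s) k≢s
        | dec-false (k <? s) k≮s
  = ∣below-suc∣ s α

occurs : (α : Vec Letter n) → 1 ≤ occurrences k α → ∃[ i ] lookup α i ≡ [ k ]
occurs {k = k} (x ∷ α) 1≤ with x ≟ᴸ [ k ]
... | yes x≡k = zero , x≡k
... | no  _   with i , eq ← occurs α 1≤ = suc i , eq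

lookup≤maxFinite : (α : Vec Letter n) (i : Fin n) → lookup α i ≡ [ k ] → k ≤ maxFinite α
lookup≤maxFinite ([ k ] ∷ α) zero    refl = m≤m⊔n k _
lookup≤maxFinite ([ k ] ∷ α) (suc i) eq   = ≤-trans (lookup≤maxFinite α i eq) (m≤n⊔m k _)
lookup≤maxFinite (∞ ∷ α)     (suc i) eq   = lookup≤maxFinite α i eq

maxFinite≤ : (α : Vec Letter n) → (∀ i {k} → lookup α i ≡ [ k ] → k ≤ m) → maxFinite α ≤ m
maxFinite≤ []          b = z≤n
maxFinite≤ ([ k ] ∷ α) b = ⊔-lub (b zero refl) (maxFinite≤ α (b ∘ suc))
maxFinite≤ (∞ ∷ α)     b = maxFinite≤ α (b ∘ suc)

-- Marks

-- A recursive form of the field `marked`, with the letter advancing along the list, so that it runs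
-- in parallel with `IsFYAbove`.
Marks : ℕ → List ℕ → Vec Letter n → Set
Marks s []      α = ⊤
Marks s (a ∷ f) α = 1 ≤ a × a ≤ occurrences s α ∸ 1 × Marks (suc s) f α

marks⁺ : ∀ s f (α : Vec Letter n) →
         (∀ (i : Fin (length f)) → 1 ≤ List.lookup f i ×
                                   List.lookup f i ≤ occurrences (s + toℕ i) α ∸ 1) →
         Marks s f α
marks⁺ s []      α h = tt
marks⁺ s (a ∷ f) α h =
  proj₁ (h zero) ,
  subst (λ k → a ≤ occurrences k α ∸ 1) (+-identityʳ s) (proj₂ (h zero)) ,
  marks⁺ (suc s) f α λ i → proj₁ (h (suc i)) ,
    subst (λ k → List.lookup f i ≤ occurrences k α ∸ 1) (+-suc s (toℕ i)) (proj₂ (h (suc i)))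

marks⁻ : ∀ s f (α : Vec Letter n) → Marks s f α →
         ∀ (i : Fin (length f)) → 1 ≤ List.lookup f i ×
                                  List.lookup f i ≤ occurrences (s + toℕ i) α ∸ 1
marks⁻ s (a ∷ f) α (1≤a , a≤ , h) zero    =
  1≤a , subst (λ k → a ≤ occurrences k α ∸ 1) (sym (+-identityʳ s)) a≤
marks⁻ s (a ∷ f) α (1≤a , a≤ , h) (suc i) =
  let 1≤b , b≤ = marks⁻ (suc s) f α h i in
  1≤b , subst (λ k → List.lookup f i ≤ occurrences k α ∸ 1) (sym (+-suc s (toℕ i))) b≤

-- Positivity of `m` excludes `n = 0`, the only case where the subtraction truncates.
m≤n∸1⇒m<n : 1 ≤ m → m ≤ n ∸ 1 → m < n
m≤n∸1⇒m<n {n = zero}  1≤m m≤ = contradiction (≤-trans 1≤m m≤) λ ()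
m≤n∸1⇒m<n {n = suc n} 1≤m m≤ = s≤s m≤

-- A mark between 1 and the number of occurrences minus 1 forces two occurrences. Hence every letter
-- from 1 to `length f` is present, and the bound on letters makes `length f` the maximum.
isCode : ∀ f (α : Vec Letter n) → Marks 1 f α →
         (∀ i {k} → lookup α i ≡ [ k ] → k ≤ length f) → IsCode (α , f)
isCode f α h bound = record
  { domain      = domain
  ; occursTwice = subst (λ m → ∀ (i : Fin m) → 2 ≤ occurrences (suc (toℕ i)) α) domain twice
  ; marked      = marked
  }
  where
  marked = marks⁻ 1 f α h
  twice : ∀ i → 2 ≤ occurrences (suc (toℕ i)) α
  twice i = let 1≤a , a≤ = marked i in ≤-trans (s≤s 1≤a) (m≤n∸1⇒m<n 1≤a a≤)
  reached : ∀ {l} → l ≤ length f → l ≤ maxFinite α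
  reached {zero}  l≤ = z≤n
  reached {suc l} l≤ =
    let i , eq = occurs α (≤-trans (s≤s z≤n) (twice (fromℕ< l≤)))
    in subst (λ l → suc l ≤ maxFinite α) (toℕ-fromℕ< l≤) (lookup≤maxFinite α i eq)
  domain = ≤-antisym (reached ≤-refl) (maxFinite≤ α bound)

code-marks : ∀ f (α : Vec Letter n) → IsCode (α , f) → Marks 1 f α
code-marks f α c = marks⁺ 1 f α (IsCode.marked c)

code-bound : ∀ f (α : Vec Letter n) → IsCode (α , f) →
             ∀ i {k} → lookup α i ≡ [ k ] → k < 1 + length f
code-bound f α c i eq =
  s≤s (≤-trans (lookup≤maxFinite α i eq) (≤-reflexive (sym (IsCode.domain c))))

-- A mark f(k) uses at most all but one of the occurrences of k.
sum-marks : ∀ s f (α : Vec Letter n) → Marks s f α →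
            (sum f + length f) + ∣ below s α ∣ ≤ n
sum-marks s []      α _             = ∣p∣≤n (below s α)
sum-marks s (a ∷ f) α (1≤a , a≤ , h) = begin
  (a + sum f + suc (length f)) + b   ≡⟨ cong (_+ b) (+-suc (a + sum f) _) ⟩
  suc (a + sum f + length f) + b     ≡⟨ cong (λ x → suc x + b) (+-assoc a _ _) ⟩
  suc a + r + b                      ≡⟨ cong (_+ b) (+-comm (suc a) r) ⟩
  r + suc a + b                      ≡⟨ +-assoc r (suc a) b ⟩
  r + (suc a + b)                    ≤⟨ +-monoʳ-≤ r (+-monoˡ-≤ b (m≤n∸1⇒m<n 1≤a a≤)) ⟩
  r + (occurrences s α + b)          ≡⟨ cong (λ x → r + x) (∣below-suc∣ s α) ⟨
  r + ∣ below (suc s) α ∣            ≤⟨ sum-marks (suc s) f α h ⟩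
  _                                  ∎
  where
  open ≤-Reasoning
  b = ∣ below s α ∣
  r = sum f + length f

-- Flags of subsets and words

-- The flag of sublevel sets of a word, with the marks as exponents: the inverse of reading off
-- letters by `blockLetter`.
chain : ℕ → List ℕ → Vec Letter n → Monomial n
chain s []      α = []
chain s (a ∷ f) α = (below (suc s) α , a) ∷ chain (suc s) f α

exponents-chain : ∀ s f (α : Vec Letter n) → exponents (chain s f α) ≡ f
exponents-chain s []      α = refl
exponents-chain s (a ∷ f) α = cong (a ∷_) (exponents-chain (suc s) f α)

∣below∣-diff : ∀ s (α : Vec Letter n) →
               ∣ below (suc s) α ∣ ∸ ∣ below s α ∣ ≡ occurrences s α
∣below∣-diff s α =
  trans (cong (_∸ ∣ below s α ∣) (∣below-suc∣ s α)) (m+n∸n≡m _ ∣ below s α ∣)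

below-⊂ : (α : Vec Letter n) → 1 ≤ occurrences s α → below s α ⊂ below (suc s) α
below-⊂ α 1≤ =
  let i , eq = occurs α 1≤ in
  (λ i∈ → let _ , eq , k<s = ∈-below⁻ i∈ in ∈-below⁺ eq (m<n⇒m<1+n k<s)) ,
  i , ∈-below⁺ eq (n<1+n _) ,
  λ i∈ → let _ , eq′ , k<s = ∈-below⁻ i∈ in
    n≮n _ (subst (_< _) ([]-injective (trans (sym eq′) eq)) k<s)

-- The cardinality gap at each step is the number of occurrences of `s`, so the bounds on marks are
-- the bounds on exponents. An occurrence of `s` makes the inclusion strict.
isFYAbove-chain : ∀ s f (α : Vec Letter n) → Marks s f α → IsFYAbove (below s α) (chain s f α)
isFYAbove-chain s []      α _              = tt
isFYAbove-chain s (a ∷ f) α (1≤a , a≤ , h) =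
  below-⊂ α (≤-trans 1≤a (≤-trans a≤ (m∸n≤m _ 1))) , 1≤a ,
  subst (λ k → a ≤ k ∸ 1) (sym (∣below∣-diff s α)) a≤ ,
  isFYAbove-chain (suc s) f α h

marks-chain : ∀ s f (α : Vec Letter n) → IsFYAbove (below s α) (chain s f α) → Marks s f α
marks-chain s []      α _                  = tt
marks-chain s (a ∷ f) α (_ , 1≤a , a≤ , h) =
  1≤a , subst (λ k → a ≤ k ∸ 1) (∣below∣-diff s α) a≤ , marks-chain (suc s) f α h

-- Passing between a flag and its word

Flag : Subset n → Monomial n → Set
Flag E []            = ⊤
Flag E ((F , _) ∷ u) = E ⊆ F × Flag F u

isFYAbove⇒flag : (u : Monomial n) → IsFYAbove E u → Flag E u
isFYAbove⇒flag []      _                  = tt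
isFYAbove⇒flag (_ ∷ u) ((E⊆F , _) , _ , _ , h) = E⊆F , isFYAbove⇒flag u h

blockLetter-∈ : ∀ a (u : Monomial n) → i ∈ F → i ∉ E →
                blockLetter E s ((F , a) ∷ u) i ≡ [ s ]
blockLetter-∈ {i = i} {F = F} {E = E} a u i∈F i∉E
  rewrite dec-true (i ∈? F ─ E) (x∈p∧x∉q⇒x∈p─q i∈F i∉E) = refl

blockLetter-∉ : ∀ a (u : Monomial n) → i ∉ F →
                blockLetter E s ((F , a) ∷ u) i ≡ blockLetter F (suc s) u i
blockLetter-∉ {i = i} {F = F} {E = E} a u i∉F
  rewrite dec-false (i ∈? F ─ E) (i∉F ∘ p─q⊆p F E) = refl

blockLetter-range : ∀ (E : Subset n) s u i → blockLetter E s u i ≡ [ k ] →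
                    s ≤ k × k < s + length u
blockLetter-range E s ((F , _) ∷ u) i eq with does (i ∈? F ─ E) | eq
... | true  | refl = ≤-refl , m<m+n s (s≤s z≤n)
... | false | eq′  =
  let s<k , k< = blockLetter-range F (suc s) u i eq′
  in <⇒≤ s<k , <-≤-trans k< (≤-reflexive (sym (+-suc s (length u))))

-- The word is prescribed only off `E`, where earlier letters may lie. A position of `F` is in `E`
-- or carries `s`; one outside `F` carries a letter above `s` or `∞`. So `F` is the next sublevel
-- set, and the induction continues from it.
chain-blockLetter : ∀ s u (α : Vec Letter n) → Flag E u → E ⊆ below s α →
                    (∀ i → i ∉ E → lookup α i ≡ blockLetter E s u i) →
                    chain s (exponents u) α ≡ u
chain-blockLetter s [] α _ _ _ = refl
chain-blockLetter {E = E} s ((F , a) ∷ u) α (E⊆F , flag) E⊆ agree =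
  cong₂ (λ G → (G , a) ∷_) (⊆-antisym below⊆F F⊆below)
    (chain-blockLetter (suc s) u α flag F⊆below λ i i∉F →
      trans (agree i (i∉F ∘ E⊆F)) (blockLetter-∉ a u i∉F))
  where
  F⊆below : F ⊆ below (suc s) α
  F⊆below {i} i∈F with i ∈? E
  ... | yes i∈E = let _ , eq , k<s = ∈-below⁻ (E⊆ i∈E) in ∈-below⁺ eq (m<n⇒m<1+n k<s)
  ... | no  i∉E = ∈-below⁺ (trans (agree i i∉E) (blockLetter-∈ a u i∈F i∉E)) (n<1+n s)
  below⊆F : below (suc s) α ⊆ F
  below⊆F {i} i∈ with i ∈? F
  ... | yes i∈F = i∈F
  ... | no  i∉F =
    let _ , eq , k<1+s = ∈-below⁻ i∈
        s<k , _ = blockLetter-range F (suc s) u i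
          (trans (sym (trans (agree i (i∉F ∘ E⊆F)) (blockLetter-∉ a u i∉F))) eq)
    in contradiction k<1+s (≤⇒≯ s<k)

blockLetter-chain : ∀ s f (α : Vec Letter n) i → i ∉ below s α →
                    (∀ {k} → lookup α i ≡ [ k ] → k < s + length f) →
                    blockLetter (below s α) s (chain s f α) i ≡ lookup α i
blockLetter-chain s [] α i i∉ bound with lookup α i in eq
... | ∞     = refl
-- With the marks exhausted, a finite letter would be below `s`; only `∞` remains.
... | [ k ] = contradiction (∈-below⁺ eq (subst (k <_) (+-identityʳ s) (bound refl))) i∉
blockLetter-chain s (a ∷ f) α i i∉ bound with i ∈? below (suc s) α
... | no  i∉′ = trans (blockLetter-∉ a (chain (suc s) f α) i∉′)
  (blockLetter-chain (suc s) f α i i∉′ λ eq → <-≤-trans (bound eq) (≤-reflexive (+-suc s (length f))))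
... | yes i∈ with k , eq , k≤s ← ∈-below⁻ i∈ with m≤n⇒m<n∨m≡n (s≤s⁻¹ k≤s)
...   | inj₁ k<s  = contradiction (∈-below⁺ eq k<s) i∉
...   | inj₂ refl = trans (blockLetter-∈ a (chain (suc s) f α) i∈ i∉) (sym eq)

-- Codes as flags with a possibly empty set of zeros

-- The exponent 1 is immaterial, since blockLetter ignores exponents.
code : Subset n → Monomial n → MarkedWord n
code F v = tabulate (blockLetter ⊥ 0 ((F , 1) ∷ v)) , exponents v

-- Regarding `F` as the first block above `⊥`, numbered 0, recovers `F` and `v` at once.
chain-code : ∀ (F : Subset n) v → IsFYAbove F v →
             let α , f = code F v in below 1 α ≡ F × chain 1 f α ≡ v
chain-code F v h =
  let eq  = chain-blockLetter 0 ((F , 1) ∷ v) (proj₁ (code F v)) (⊥⊆ , isFYAbove⇒flag v h)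
              ⊥⊆ (λ i _ → Vec.lookup∘tabulate _ i)
      eq₁ , eq₂ = List.∷-injective eq
  in Product.,-injectiveˡ eq₁ , eq₂

isCode-code : ∀ (F : Subset n) v → IsFYAbove F v → IsCode (code F v)
isCode-code F v h = isCode (exponents v) w
  (marks-chain 1 (exponents v) w (subst₂ IsFYAbove (sym eq₁) (sym eq₂) h))
  λ i eq → s≤s⁻¹ (subst (λ l → _ < suc l) (sym (List.length-map proj₂ v))
    (proj₂ (blockLetter-range ⊥ 0 ((F , 1) ∷ v) i (trans (sym (Vec.lookup∘tabulate _ i)) eq))))
  where
  w = proj₁ (code F v)
  eq₁ = proj₁ (chain-code F v h)
  eq₂ = proj₂ (chain-code F v h)

code-chain : ∀ f (α : Vec Letter n) → IsCode (α , f) →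
             code (below 1 α) (chain 1 f α) ≡ (α , f)
code-chain f α c = cong₂ _,_
  (trans (Vec.tabulate-cong letter) (Vec.tabulate∘lookup α)) (exponents-chain 1 f α)
  where
  letter : ∀ i → blockLetter ⊥ 0 (chain 0 (1 ∷ f) α) i ≡ lookup α i
  -- The set `below 0 α` equals `⊥` only up to a proof, so the base set is transported.
  letter i = subst (λ E → i ∉ E → blockLetter E 0 (chain 0 (1 ∷ f) α) i ≡ lookup α i)
    (below-zero α) (λ i∉ → blockLetter-chain 0 (1 ∷ f) α i i∉ (code-bound f α c i)) ∉⊥


-- Monomials as flags with a possibly empty set of zeros

bump : Monomial n → Monomial n
bump []            = []
bump ((F , a) ∷ u) = (F , suc a) ∷ u

-- A monomial with a₁ = 1 has F₁ as its set of zeros; one with a₁ ≥ 2 (or the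
-- monomial 1) has no zeros.
monomial : Subset n → Monomial n → Monomial n
monomial F v with nonempty? F
... | yes _ = (F , 1) ∷ v
... | no  _ = bump v

isFY-bump : (v : Monomial n) → IsFYAbove ⊥ v → IsFY (bump v)
isFY-bump []            _                  = tt
isFY-bump {n} ((F , a) ∷ v) (⊥⊂F , 1≤a , a≤ , h) =
  ⊥⊂F , s≤s z≤n ,
  m≤n∸1⇒m<n 1≤a (subst (λ k → a ≤ ∣ F ∣ ∸ k ∸ 1) (∣⊥∣≡0 n) a≤) , h

isFY-monomial : ∀ (F : Subset n) v → IsFYAbove F v → IsFY (monomial F v)
isFY-monomial {n} F v h with nonempty? F
... | yes (x , x∈F) = (⊥⊆ , x , x∈F , ∉⊥) , ≤-refl ,
  subst (_< ∣ F ∣) (∣⊥∣≡0 n) (p⊂q⇒∣p∣<∣q∣ (⊥⊆ , x , x∈F , ∉⊥)) , h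
... | no  F-empty   = isFY-bump v (subst (λ E → IsFYAbove E v) (Empty-unique F-empty) h)

monomial-⊥ : (v : Monomial n) → monomial ⊥ v ≡ bump v
monomial-⊥ {n} v with nonempty? (⊥ {n})
... | yes (_ , x∈⊥) = contradiction x∈⊥ ∉⊥
... | no  _         = refl

monomial-nonempty : ∀ (F : Subset n) v → Nonempty F → monomial F v ≡ (F , 1) ∷ v
monomial-nonempty F v ne with nonempty? F
... | yes _       = refl
... | no  F-empty = contradiction ne F-empty

-- Every monomial arises from a pair, which reduces statements about `φ` to statements about `code`.
isFY⇒monomial : (u : Monomial n) → IsFY u →
                ∃[ F ] ∃[ v ] (IsFYAbove F v × monomial F v ≡ u)
isFY⇒monomial [] _ = ⊥ , [] , tt , monomial-⊥ []
isFY⇒monomial ((F , suc zero) ∷ v) ((_ , x , x∈F , _) , _ , _ , h) =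
  F , v , h , monomial-nonempty F v (x , x∈F)
isFY⇒monomial {n} ((F , suc (suc a)) ∷ v) (⊥⊂F , _ , a≤ , h) =
  ⊥ , (F , suc a) ∷ v ,
  (⊥⊂F , s≤s z≤n ,
   subst (λ k → suc a ≤ ∣ F ∣ ∸ k ∸ 1) (sym (∣⊥∣≡0 n)) (∸-monoˡ-≤ 1 a≤) , h) ,
  monomial-⊥ _

-- The map `φ` and its inverse on underlying data

tabulate-const : ∀ n {A : Set} (x : A) → tabulate {n = n} (λ _ → x) ≡ replicate n x
tabulate-const zero    x = refl
tabulate-const (suc n) x = cong (x ∷_) (tabulate-const n x)

-- An empty zero block assigns no letter, so numbering from 0 with that block agrees with numbering
-- from 1 without it.
φ-bump : (v : Monomial n) → IsFYAbove ⊥ v → φ (bump v) ≡ code ⊥ v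
φ-bump {n} v h = trans (unfold v h)
  (cong (_, exponents v) (Vec.tabulate-cong λ i → sym (blockLetter-∉ {E = ⊥} 1 v ∉⊥)))
  where
  unfold : ∀ v → IsFYAbove ⊥ v → φ (bump v) ≡ (tabulate (blockLetter ⊥ 1 v) , exponents v)
  unfold []                _                = cong (_, []) (sym (tabulate-const n ∞))
  unfold ((F , suc a) ∷ v) _                = refl
  -- Here `bump` would give exponent 1 and select the other clause of `φ`; the gap condition
  -- excludes it.
  unfold ((F , zero)  ∷ v) (_ , () , _ , _)

φ-monomial : ∀ (F : Subset n) v → IsFYAbove F v → φ (monomial F v) ≡ code F v
φ-monomial F v h with nonempty? F
... | yes _       = refl
... | no  F-empty rewrite Empty-unique F-empty = φ-bump v h

isCode-φ : (u : Monomial n) → IsFY u → IsCode (φ u)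
isCode-φ u h with F , v , h′ , refl ← isFY⇒monomial u h =
  subst IsCode (sym (φ-monomial F v h′)) (isCode-code F v h′)

ψ : MarkedWord n → Monomial n
ψ (α , f) = monomial (below 1 α) (chain 1 f α)

isFYAbove-code : ∀ f (α : Vec Letter n) → IsCode (α , f) → IsFYAbove (below 1 α) (chain 1 f α)
isFYAbove-code f α c = isFYAbove-chain 1 f α (code-marks f α c)

isFY-ψ : (c : MarkedWord n) → IsCode c → IsFY (ψ c)
isFY-ψ (α , f) c = isFY-monomial _ _ (isFYAbove-code f α c)

φ-ψ : (c : MarkedWord n) → IsCode c → φ (ψ c) ≡ c
φ-ψ (α , f) c = trans (φ-monomial _ _ (isFYAbove-code f α c)) (code-chain f α c)

ψ-φ : (u : Monomial n) → IsFY u → ψ (φ u) ≡ u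
ψ-φ u h with F , v , h′ , refl ← isFY⇒monomial u h =
  trans (cong ψ (φ-monomial F v h′))
    (let eq₁ , eq₂ = chain-code F v h′ in cong₂ monomial eq₁ eq₂)

-- Degree and index

word≢∞ : ∀ s a (u : Monomial n) → Nonempty F →
         tabulate (blockLetter ⊥ s ((F , a) ∷ u)) ≢ replicate n ∞
word≢∞ s a u (x , x∈F) eq = contradiction
  (trans (sym (trans (Vec.lookup∘tabulate _ x) (blockLetter-∈ a u x∈F ∉⊥)))
  (trans (cong (λ α → lookup α x) eq) (Vec.lookup-replicate x ∞))) λ ()

ind-finite : ∀ {α : Vec Letter n} f {h} → α ≢ replicate n ∞ → ind ((α , f) , h) ≡ + sum f
ind-finite {n} {α} f α≢ rewrite dec-false (Vec.≡-dec _≟ᴸ_ α (replicate n ∞)) α≢ = refl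

-- A factor of exponent 1 is dropped, or the first exponent is lowered by one; either way the sum
-- falls by one. A point of the first set has a finite letter, so the index is the sum of marks.
deg-φ : ∀ (u : Monomial n) {h} → IsFY u → + sum (exponents u) ≡ ind (φ u , h) +ᶻ 1ℤ
deg-φ {n} [] _ rewrite dec-true (Vec.≡-dec _≟ᴸ_ (replicate n ∞) (replicate n ∞)) refl = refl
deg-φ ((F , suc zero) ∷ v) {h} ((_ , x , x∈F , _) , _) =
  trans (cong +_ (+-comm 1 (sum (exponents v))))
    (cong (_+ᶻ 1ℤ) (sym (ind-finite (exponents v) {h} (word≢∞ 0 1 v (x , x∈F)))))
deg-φ ((F , suc (suc a)) ∷ v) {h} ((_ , x , x∈F , _) , _) =
  trans (cong +_ (+-comm 1 (suc a + sum (exponents v))))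
    (cong (_+ᶻ 1ℤ) (sym (ind-finite (suc a ∷ exponents v) {h}
      (word≢∞ 1 (suc (suc a)) v (x , x∈F)))))

-1≤ind : (c : Code n) → -1ℤ ≤ᶻ ind c
-1≤ind {n} ((α , f) , _) with does (Vec.≡-dec _≟ᴸ_ α (replicate n ∞))
... | true  = ℤ.≤-refl
... | false = -≤+

sum≤ : ∀ f (α : Vec Letter (suc n)) → Marks 1 f α → sum f ≤ n
sum≤ []      α _ = z≤n
-- The nonempty list of marks has positive length, which makes the bound from `sum-marks` strict.
sum≤ (a ∷ f) α h = s≤s⁻¹ (≤-trans (m<m+n _ (s≤s z≤n)) (m+n≤o⇒m≤o _ (sum-marks 1 (a ∷ f) α h)))

ind≤ : ∀ (c : MarkedWord (suc n)) {h} → IsCode c → ind (c , h) ≤ᶻ + n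
ind≤ {n} (α , f) h with does (Vec.≡-dec _≟ᴸ_ α (replicate (suc n) ∞))
... | true  = -≤+
... | false = +≤+ (sum≤ f α (code-marks f α h))

-- Equivariance

lookup-─ : ∀ (F E : Subset n) i → lookup (F ─ E) i ≡ lookup F i ∧ not (lookup E i)
lookup-─ (x ∷ F) (true  ∷ E) zero    = sym (Bool.∧-zeroʳ x)
lookup-─ (x ∷ F) (false ∷ E) zero    = sym (Bool.∧-identityʳ x)
lookup-─ (x ∷ F) (y     ∷ E) (suc i) = lookup-─ F E i

act-─ : ∀ σ (F E : Subset n) → act σ F ─ act σ E ≡ act σ (F ─ E)
act-─ σ F E = trans (sym (Vec.tabulate∘lookup _)) (Vec.tabulate-cong λ i →
  trans (lookup-─ (act σ F) (act σ E) i)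
  (trans (cong₂ (λ x y → x ∧ not y) (lookup-act σ F i) (lookup-act σ E i))
  (sym (lookup-─ F E (σ ⟨$⟩ˡ i)))))

does-∈-act : ∀ σ (F : Subset n) i → does (i ∈? act σ F) ≡ does (σ ⟨$⟩ˡ i ∈? F)
does-∈-act σ F i = does-⇔ (mk⇔ (∈-act⁻ σ F)
  (λ h → subst (_∈ act σ F) (inverseʳ σ) (∈-act⁺ σ F h))) (i ∈? act σ F) (σ ⟨$⟩ˡ i ∈? F)

act-replicate : ∀ {A : Set} σ (x : A) → act σ (replicate n x) ≡ replicate n x
act-replicate {n} σ x =
  trans (Vec.tabulate-cong λ i → Vec.lookup-replicate (σ ⟨$⟩ˡ i) x) (tabulate-const n x)

blockLetter-act : ∀ σ (E : Subset n) s u i →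
                  blockLetter (act σ E) s (actMonomial σ u) i ≡ blockLetter E s u (σ ⟨$⟩ˡ i)
blockLetter-act σ E s []            i = refl
blockLetter-act σ E s ((F , _) ∷ u) i
  rewrite act-─ σ F E | does-∈-act σ (F ─ E) i | blockLetter-act σ F (suc s) u i = refl

word-act : ∀ σ s (u : Monomial n) → tabulate (blockLetter ⊥ s (actMonomial σ u)) ≡
                                    act σ (tabulate (blockLetter ⊥ s u))
word-act σ s u = Vec.tabulate-cong λ i →
  -- The starting set `⊥` is invariant, so it is rewritten as its own image under `σ`.
  trans (cong (λ E → blockLetter E s (actMonomial σ u) i) (sym (act-replicate σ false)))
  (trans (blockLetter-act σ ⊥ s u i) (sym (Vec.lookup∘tabulate _ (σ ⟨$⟩ˡ i))))

exponents-act : ∀ σ (u : Monomial n) → exponents (actMonomial σ u) ≡ exponents u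
exponents-act σ u = sym (List.map-∘ u)

φ-act : ∀ σ (u : Monomial n) → let α , f = φ u in φ (actMonomial σ u) ≡ (act σ α , f)
φ-act σ []                        = cong (_, []) (sym (act-replicate σ ∞))
-- The last clause of `φ` applies, with first mark `0 ∸ 1 = 0`.
φ-act σ u@((F , zero)        ∷ v) =
  cong₂ (λ α f → α , 0 ∷ f) (word-act σ 1 u) (exponents-act σ v)
φ-act σ u@((F , suc zero)    ∷ v) = cong₂ _,_ (word-act σ 0 u) (exponents-act σ v)
φ-act σ u@((F , suc (suc a)) ∷ v) =
  cong₂ (λ α f → α , suc a ∷ f) (word-act σ 1 u) (exponents-act σ v)

-- Assembly of the bijection

_≟ᶜ_ : DecidableEquality (MarkedWord n)
_≟ᶜ_ = Product.≡-dec (Vec.≡-dec _≟ᴸ_) (List.≡-dec ℕ._≟_)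

_≟ᵐ_ : DecidableEquality (Monomial n)
_≟ᵐ_ = List.≡-dec (Product.≡-dec (Vec.≡-dec Bool._≟_) ℕ._≟_)

theorem4p7 : ∀ (n : ℕ) → 1 ≤ n →
    (∀ (c : Code n) → ∃[ j ] (-1ℤ ≤ᶻ j × j ≤ᶻ + n -ᶻ 1ℤ × c ∈Code[ j ]))
    × (Σ[ φ̃ ∈ (FY n → Code n) ]
    ((∀ (u : FY n) → value (φ̃ u) ≡ φ (value u))
    × Bijective _≡_ _≡_ φ̃
    × (∀ (u : FY n) → + deg u ≡ ind (φ̃ u) +ᶻ 1ℤ)
    × (∀ (σ : Permutation′ n) (u : FY n) → φ̃ (σ •ᶠ u) ≡ σ •ᶜ φ̃ u)))
theorem4p7 (suc n) _ =
  -- Membership proofs are irrelevant; since the inequality is decidable, `recompute` turns an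
  -- irrelevant proof of it into a relevant one.
  (λ { c@(d , [ h ]) → ind c , -1≤ind c , recompute (ind c ℤ.≤? + n) (ind≤ d {[ h ]} h) , refl }) ,
  φ̃ , (λ _ → refl) , (injective , surjective) ,
  (λ { (u , [ h ]) → recompute (_ ℤ.≟ ind (φ̃ (u , [ h ])) +ᶻ 1ℤ) (deg-φ u {proof (φ̃ (u , [ h ]))} h) }) ,
  λ σ u → value-injective (φ-act σ (value u))
  where
  φ̃ : FY (suc n) → Code (suc n)
  φ̃ (u , [ h ]) = φ u , [ isCode-φ u h ]

  ψ̃ : Code (suc n) → FY (suc n)
  ψ̃ (c , [ h ]) = ψ c , [ isFY-ψ c h ]

  ψ̃-φ̃ : ∀ u → ψ̃ (φ̃ u) ≡ u
  ψ̃-φ̃ (u , [ h ]) = value-injective (recompute (_ ≟ᵐ u) (ψ-φ u h))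

  φ̃-ψ̃ : ∀ c → φ̃ (ψ̃ c) ≡ c
  φ̃-ψ̃ (c , [ h ]) = value-injective (recompute (_ ≟ᶜ c) (φ-ψ c h))

  injective : ∀ {u v} → φ̃ u ≡ φ̃ v → u ≡ v
  injective {u} {v} eq = trans (sym (ψ̃-φ̃ u)) (trans (cong ψ̃ eq) (ψ̃-φ̃ v))

  surjective : ∀ c → ∃[ u ] (∀ {v} → v ≡ u → φ̃ v ≡ c)
  surjective c = ψ̃ c , λ { refl → φ̃-ψ̃ c }
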